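{- Let $n\ge1$. The map $\vartheta:\mathcal{RB}_n\to\mathcal{RB}_n$ is an involution that preserves the right chain sequences and switches the statistics $\mathsf{spi}$ and $\mathsf{rspi}$ (i.e. $\mathsf{spi}(\vartheta(T))=\mathsf{rspi}(T)$ and $\mathsf{rspi}(\vartheta(T))=\mathsf{spi}(T)$ for all $T\in\mathcal{RB}_n$).
   Context: A binary tree is a rooted tree in which each node has at most one left child and at most one right child. A right increasing binary tree on $[n]=\{1,\dots,n\}$ is a binary tree with $n$ nodes labeled bijectively by $[n]$ such that the label of each right child is greater than that of its parent; $\mathcal{RB}_n$ is the set of these. The preorder visits, recursively, the parent, then its left subtree, then its right subtree. The reverse preorder visits, recursively, the right subtree, then the left subtree, then the parent. The following depend only on the underlying binary tree. $\mathsf{spi}$ is the smallest $i$ such that the $(i+1)$-th node under the preorder is a right child. $\mathsf{rspi}$ is the smallest $i$ such that the $(i+1)$-th node under the reverse preorder has a right child. By convention, for a binary tree with $n$ nodes and only left edges, $\mathsf{spi}=\mathsf{rspi}=n$. A right chain is a maximal path composed only of right edges (single nodes with no incident right edge count as right chains of length $0$); its length is its number of right edges; the right chain sequence is the multiset of the lengths of all right chains. The map $\vartheta$: let $T\in\mathcal{RB}_n$ and let $v_i$ be its $i$-th node under the preorder. Then $\vartheta(T)$ is the tree on the nodes $v_1,\dots,v_n$ with root $v_n$ such that, for $i$ from $n-1$ down to $1$: if $v_i$ has right child $v_\ell$ in $T$, then $v_i$ is the right child of $v_\ell$ in $\vartheta(T)$; otherwise $v_i$ is the left child of $v_{i+1}$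 in $\vartheta(T)$. Moreover, a node is labeled $i$ in $\vartheta(T)$ iff it is labeled $n+1-i$ in $T$. -}

module Defs where

open import Data.Bool.Base using (Bool; true; false; if_then_else_)
open import Data.Fin.Base using (Fin; toℕ; opposite; _<_)
open import Data.Fin.Properties using (_≟_)
open import Data.List.Base using (List; []; _∷_; [_]; _++_; length; allFin; findIndexᵇ)
open import Data.List.Relation.Binary.Permutation.Propositional using (_↭_)
open import Data.Maybe.Base using (Maybe; just; nothing; maybe′; is-just)
open import Data.Maybe.Relation.Unary.All using (All)
open import Data.Nat.Base using (ℕ; suc)
open import Data.Product.Base using (_×_; _,_; proj₂)
open import Data.Tree.Binary using (Tree; leaf; node; mapₙ; module Prefix)
open import Data.Unit.Base using (⊤; tt)
open import Function.Base using (_∘_; id)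
open import Relation.Nullary.Decidable.Core using (does)

private
  variable
    A : Set
    n : ℕ

-- The nodes of a binary tree are the `node`s; a library `leaf` marks an
-- absent child.
BinTree : Set → Set
BinTree A = Tree A ⊤

pattern nil = leaf tt

root : BinTree A → Maybe A
root nil          = nothing
root (node _ x _) = just x

-- Parent, left subtree, right subtree.
preorder : BinTree A → List A
preorder = Prefix.toList

-- Right subtree, left subtree, parent.
revPreorder : BinTree A → List A
revPreorder nil          = []
revPreorder (node l x r) = revPreorder r ++ revPreorder l ++ [ x ]

RightIncreasing : BinTree (Fin n) → Set
RightIncreasing nil          = ⊤
RightIncreasing (node l x r) =
  All (x <_) (root r) × RightIncreasing l × RightIncreasing r

-- The label i of {1,…,n} is represented by the element of Fin n with value
-- i - 1.  Being a permutation of allFin n says that there are n nodes and that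
-- every label is used exactly once.
record RB (n : ℕ) (T : BinTree (Fin n)) : Set where
  field
    labels          : preorder T ↭ allFin n
    rightIncreasing : RightIncreasing T

withRightChild : BinTree A → BinTree (A × Maybe A)
withRightChild nil          = nil
withRightChild (node l x r) =
  node (withRightChild l) (x , root r) (withRightChild r)

hasRightChild : BinTree A → BinTree Bool
hasRightChild = mapₙ (is-just ∘ proj₂) ∘ withRightChild

-- The first argument says whether the root is itself a right child, when the
-- tree is considered as a subtree of a larger one.
isRightChild : Bool → BinTree A → BinTree Bool
isRightChild b nil          = nil
isRightChild b (node l _ r) = node (isRightChild false l) b (isRightChild true r)

-- Positions are counted from 0, so the smallest i such that the (i+1)-th entry
-- is true is the index of the first true entry.  If there is none (for the two
-- statistics below: no right edges), the value is the number of nodes.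
firstTrue : List Bool → ℕ
firstTrue bs = maybe′ toℕ (length bs) (findIndexᵇ id bs)

spi : BinTree A → ℕ
spi T = firstTrue (preorder (isRightChild false T))

rspi : BinTree A → ℕ
rspi T = firstTrue (revPreorder (hasRightChild T))

-- Given the right subtree of a node v, the number of edges of the path that
-- starts at v and follows right edges as long as possible.
rightEdges : BinTree A → ℕ
rightEdges nil          = 0
rightEdges (node _ _ r) = suc (rightEdges r)

-- A right chain is determined by its top node, which is a node that is not a
-- right child.  The Boolean is as in isRightChild.
rightChains : Bool → BinTree A → List ℕ
rightChains b     nil          = []
rightChains false (node l _ r) =
  rightEdges r ∷ rightChains false l ++ rightChains true r
rightChains true  (node l _ r) = rightChains false l ++ rightChains true r

-- A multiset is represented by a list, to be compared up to _↭_.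
rightChainSequence : BinTree A → List ℕ
rightChainSequence = rightChains false

-- Add a new node v as the left (right) child of the node labelled u.  Labels
-- are distinct where these are used, so u names a single node.
attachLeft attachRight : (u v : Fin n) → BinTree (Fin n) → BinTree (Fin n)
attachLeft u v nil          = nil
attachLeft u v (node l x r) =
  if does (x ≟ u)
  then node (node nil v nil) x r
  else node (attachLeft u v l) x (attachLeft u v r)
attachRight u v nil          = nil
attachRight u v (node l x r) =
  if does (x ≟ u)
  then node l x (node nil v nil)
  else node (attachRight u v l) x (attachRight u v r)

-- The argument lists v₁,…,vₙ in preorder, each with its right child in T.  The
-- recursion starts from the single node vₙ and then inserts vₙ₋₁,…,v₁ in turn.
build : List (Fin n × Maybe (Fin n)) → BinTree (Fin n)
build []                                 = nil
build ((v , _) ∷ [])                     = node nil v nil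
build ((v , just w)  ∷ vs@(_ ∷ _))       = attachRight w v (build vs)
build ((v , nothing) ∷ vs@((u , _) ∷ _)) = attachLeft u v (build vs)

-- `opposite` sends the label i to n + 1 - i.
ϑ : BinTree (Fin n) → BinTree (Fin n)
ϑ T = mapₙ opposite (build (preorder (withRightChild T)))

{-# OPTIONS --safe #-}
module Submission where

-- Before relabelling, ϑ turns the tree around: the node inserted last is the
-- root of T, and it has no children when it is inserted.  Writing turn T L R
-- for the result with L and R hung below that node gives a recursion on T that
-- does not mention labels: first the right subtree is turned, the turned left
-- subtree hangs below its root on the left, and the root of T on the right.
-- The preorder of turn T nil nil is the preorder of T reversed, that is, the
-- reverse preorder of T, and a node is a right child there iff it has a right
-- child in T; so spi (ϑ T) ≡ rspi T, and the other equation follows because ϑ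
-- is an involution.

open import Defs
open import Data.Bool.Base using (Bool; true; false)
open import Data.Empty using (⊥)
open import Data.Fin.Base using (Fin; opposite; _<_)
open import Data.Fin.Properties using (_≟_; toℕ<n; opposite-prop; opposite-involutive)
open import Data.List.Base using (List; []; _∷_; [_]; _++_; map; allFin)
open import Data.List.Membership.Propositional using (_∈_)
open import Data.List.Membership.Propositional.Properties using (∈-allFin; ∈-map⁺)
open import Data.List.Membership.Propositional.Properties.WithK using (unique∧set⇒bag)
open import Data.List.Properties using (++-assoc; ++-identityʳ)
open import Data.List.Relation.Binary.BagAndSetEquality using (∼bag⇒↭)
open import Data.List.Relation.Binary.Permutation.Propositional
  using (_↭_; prep; ↭-refl; ↭-sym; ↭-reflexive; ↭⇒↭ₛ; module PermutationReasoning)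
import Data.List.Relation.Binary.Permutation.Propositional.Properties as Perm
import Data.List.Relation.Binary.Permutation.Setoid.Properties as PermSetoid
import Data.List.Relation.Unary.All as ListAll
import Data.List.Relation.Unary.AllPairs as AllPairs
open import Data.List.Relation.Unary.Unique.Propositional using (Unique)
import Data.List.Relation.Unary.Unique.Propositional.Properties as Unique
open import Data.Maybe.Base using (Maybe; just; nothing)
open import Data.Maybe.Relation.Unary.All as MaybeAll using (All; just; nothing)
open import Data.Nat.Base using (ℕ; suc; s≤s; _+_; _≤_)
import Data.Nat.Properties as ℕ
open import Data.Product.Base using (_×_; _,_)
open import Data.Tree.Binary using (node; mapₙ; module Prefix)
open import Data.Tree.Binary.Properties using (map-id; map-cong; map-compose)
open import Data.Unit.Base using (⊤; tt)
open import Function.Base using (_∘_; id)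
open import Function.Bundles using (mk⇔)
open import Relation.Binary.PropositionalEquality
  using (_≡_; _≢_; refl; sym; trans; cong; cong₂; subst; setoid; module ≡-Reasoning)
open import Relation.Nullary.Decidable using (dec-true; dec-false)

private
  variable
    A B : Set
    n : ℕ

open Prefix using () renaming (toDiffList to preorderOnto)

-- Turning a tree around, and involutivity of the turn.

mutual
  turn : BinTree A → BinTree A → BinTree A → BinTree A
  turn nil          L R = L
  turn (node l x r) L R = turnChildren l r (node L x R)

  -- `S` is the turned subtree topped by the parent of `l` and `r`. It goes right of the root of
  -- `r`, reversing that edge, or if `r` is empty, left of the next node in preorder, the root of
  -- `l`.
  turnChildren : BinTree A → BinTree A → BinTree A → BinTree A
  turnChildren l nil            S = turn l S nil
  turnChildren l r@(node _ _ _) S = turn r (turn l nil nil) S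

-- turn nil L R discards R, so the equations below need R to be nil in that case.
Fits : BinTree A → BinTree A → Set
Fits nil (node _ _ _) = ⊥
Fits _   _            = ⊤

fits-nil : (t : BinTree A) → Fits t nil
fits-nil nil          = tt
fits-nil (node _ _ _) = tt

-- The induction needs general `L` and `R`, since `turn` collects them into `node L x R`. The second
-- turn starts at the last node of `t` in preorder and works down, so it has rebuilt all of `t` when
-- it reaches `L` and `R`, the children of the root of `t`.
turn-turn : (t L R : BinTree A) → Fits t R →
            turn (turn t L R) nil nil ≡ turnChildren L R t
turn-turn nil            L nil _ = refl
turn-turn (node l x nil) L R   _ = turn-turn l (node L x R) nil (fits-nil l)
turn-turn (node l x r@(node _ _ _)) L R _ = begin
  turn (turn r (turn l nil nil) (node L x R)) nil nil
    ≡⟨ turn-turn r (turn l nil nil) (node L x R) tt ⟩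
  turn (node L x R) (turn (turn l nil nil) nil nil) r
    ≡⟨ cong (λ s → turn (node L x R) s r) (turn-turn l nil nil (fits-nil l)) ⟩
  turn (node L x R) l r
    ∎
  where open ≡-Reasoning

turn-involutive : (t : BinTree A) → turn (turn t nil nil) nil nil ≡ t
turn-involutive t = turn-turn t nil nil (fits-nil t)

turn-mapₙ : (f : A → B) (t L R : BinTree A) →
            mapₙ f (turn t L R) ≡ turn (mapₙ f t) (mapₙ f L) (mapₙ f R)
turn-mapₙ f nil            L R = refl
turn-mapₙ f (node l x nil) L R = turn-mapₙ f l (node L x R) nil
turn-mapₙ f (node l x r@(node _ _ _)) L R =
  trans (turn-mapₙ f r (turn l nil nil) (node L x R))
        (cong (λ s → turn (mapₙ f r) s (mapₙ f (node L x R))) (turn-mapₙ f l nil nil))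

-- Preorder lists with an accumulator.

preorderOnto-++ : (t : BinTree A) (ys : List A) → preorderOnto t ys ≡ preorder t ++ ys
preorderOnto-++ nil          ys = refl
preorderOnto-++ (node l x r) ys = cong (x ∷_) (begin
  preorderOnto l (preorderOnto r ys)  ≡⟨ preorderOnto-++ l _ ⟩
  preorder l ++ preorderOnto r ys     ≡⟨ cong (preorder l ++_) (preorderOnto-++ r ys) ⟩
  preorder l ++ preorder r ++ ys      ≡⟨ ++-assoc (preorder l) _ _ ⟨
  (preorder l ++ preorder r) ++ ys    ≡⟨ cong (_++ ys) (preorderOnto-++ l _) ⟨
  preorderOnto l (preorder r) ++ ys   ∎)
  where open ≡-Reasoning

preorderOnto-mapₙ : (f : A → B) (t : BinTree A) (ys : List A) →
                    preorderOnto (mapₙ f t) (map f ys) ≡ map f (preorderOnto t ys)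
preorderOnto-mapₙ f nil          ys = refl
preorderOnto-mapₙ f (node l x r) ys = cong (f x ∷_)
  (trans (cong (preorderOnto (mapₙ f l)) (preorderOnto-mapₙ f r ys))
         (preorderOnto-mapₙ f l _))

preorderOnto-suffix : (P : List A → Set) → (∀ {x xs} → P (x ∷ xs) → P xs) →
                      (t : BinTree A) {ys : List A} → P (preorderOnto t ys) → P ys
preorderOnto-suffix P drop nil          p = p
preorderOnto-suffix P drop (node l x r) p =
  preorderOnto-suffix P drop r (preorderOnto-suffix P drop l (drop p))

-- Attaching a node below a given label.

-- A map u f covers attachLeft u v and attachRight u v alike.
record ActsAt (u : A) (f : BinTree A → BinTree A) : Set where
  field
    at-nil : f nil ≡ nil
    away   : ∀ {l x r} → u ≢ x → f (node l x r) ≡ node (f l) x (f r)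

open ActsAt

attachLeft-actsAt : (u v : Fin n) → ActsAt u (attachLeft u v)
attachLeft-actsAt u v .at-nil = refl
attachLeft-actsAt u v .away {x = x} u≢x
  rewrite dec-false (x ≟ u) (u≢x ∘ sym) = refl

attachRight-actsAt : (u v : Fin n) → ActsAt u (attachRight u v)
attachRight-actsAt u v .at-nil = refl
attachRight-actsAt u v .away {x = x} u≢x
  rewrite dec-false (x ≟ u) (u≢x ∘ sym) = refl

attachLeft-here : (u v : Fin n) (l r : BinTree (Fin n)) →
                  attachLeft u v (node l u r) ≡ node (node nil v nil) u r
attachLeft-here u v l r rewrite dec-true (u ≟ u) refl = refl

attachRight-here : (u v : Fin n) (l r : BinTree (Fin n)) →
                   attachRight u v (node l u r) ≡ node l u (node nil v nil)
attachRight-here u v l r rewrite dec-true (u ≟ u) refl = refl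

module _ {u : A} {f : BinTree A → BinTree A} (act : ActsAt u f) where

  mutual
    -- No node of `t` is `u`, so `f` passes every node that `turn` places and acts only on the two
    -- trees hung below.
    turn-actsAt : ∀ t {us} → ListAll.All (u ≢_) (preorderOnto t us) →
                  ∀ L R → f (turn t L R) ≡ turn t (f L) (f R)
    turn-actsAt nil          _            L R = refl
    turn-actsAt (node l x r) (u≢x ListAll.∷ u∉) L R =
      trans (turnChildren-actsAt l r u∉ (node L x R))
            (cong (turnChildren l r) (act .away u≢x))

    turnChildren-actsAt : ∀ l r {us} →
                          ListAll.All (u ≢_) (preorderOnto l (preorderOnto r us)) →
                          ∀ S → f (turnChildren l r S) ≡ turnChildren l r (f S)
    turnChildren-actsAt l nil u∉ S =
      trans (turn-actsAt l u∉ S nil) (cong (turn l (f S)) (act .at-nil))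
    turnChildren-actsAt l r@(node _ _ _) u∉ S =
      trans (turn-actsAt r (preorderOnto-suffix (ListAll.All (u ≢_)) ListAll.tail l u∉)
                         (turn l nil nil) S)
            (cong (λ s → turn r s (f S)) turn-l)
      where
      turn-l : f (turn l nil nil) ≡ turn l nil nil
      turn-l = trans (turn-actsAt l u∉ nil nil)
                     (cong₂ (turn l) (act .at-nil) (act .at-nil))

-- Inserting nodes one by one yields the turned tree.

-- K S is the tree built from rest, with S as the left child of the node that
-- was inserted last (K S is S if rest is empty); us are the labels of rest.
record Hole (rest : List (Fin n × Maybe (Fin n))) (us : List (Fin n))
            (K : BinTree (Fin n) → BinTree (Fin n)) : Set where
  field
    empty    : build rest ≡ K nil
    single   : ∀ x → build ((x , nothing) ∷ rest) ≡ K (node nil x nil)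
    commutes : ∀ {u f} → ActsAt u f → ListAll.All (u ≢_) us → ∀ S → f (K S) ≡ K (f S)

open Hole

-- `build` computes only on a visibly nonempty tail, hence the split on `l`; `p ∷ ps` covers the
-- case of empty `l`.
build-just : (v w : Fin n) (l : BinTree (Fin n)) → ∀ p ps →
             build ((v , just w) ∷ preorderOnto (withRightChild l) (p ∷ ps))
             ≡ attachRight w v (build (preorderOnto (withRightChild l) (p ∷ ps)))
build-just v w nil          p ps = refl
build-just v w (node _ _ _) p ps = refl

module _ {rest : List (Fin n × Maybe (Fin n))} {us : List (Fin n)}
         {K : BinTree (Fin n) → BinTree (Fin n)} (h : Hole rest us K)
         {u : Fin n} {f : BinTree (Fin n) → BinTree (Fin n)} (act : ActsAt u f) where

  hole-turn-actsAt : ∀ t → ListAll.All (u ≢_) (preorderOnto t us) →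
                     ∀ S → f (K (turn t S nil)) ≡ K (turn t (f S) nil)
  hole-turn-actsAt t u∉ S =
    trans (h .commutes act (preorderOnto-suffix (ListAll.All (u ≢_)) ListAll.tail t u∉) _)
          (cong K (trans (turn-actsAt act t u∉ S nil) (cong (turn t (f S)) (act .at-nil))))

  hole-turnChildren-actsAt : ∀ l r → ListAll.All (u ≢_) (preorderOnto l (preorderOnto r us)) →
                             ∀ S → f (K (turnChildren l r S)) ≡ K (turnChildren l r (f S))
  hole-turnChildren-actsAt l r u∉ S =
    trans (h .commutes act (drop r (drop l u∉)) _)
          (cong K (turnChildren-actsAt act l r u∉ S))
    where drop = preorderOnto-suffix (ListAll.All (u ≢_)) ListAll.tail

mutual
  -- Once the nodes of `t` are inserted, the root of `t` heads the list, so the next node without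
  -- right child goes on its left, which is where `turn t` puts its second argument. Distinctness
  -- keeps the insertion from acting elsewhere.
  hole : ∀ {rest us K} (t : BinTree (Fin n)) → Hole rest us K → Unique (preorderOnto t us) →
         Hole (preorderOnto (withRightChild t) rest) (preorderOnto t us) (λ S → K (turn t S nil))
  hole nil h _ = h
  hole {K = K} t@(node l x r) h uniq@(x∉ AllPairs.∷ _) = record
    { empty    = hole-empty t h uniq
    ; single   = λ y →
        trans (cong (attachLeft x y) (hole-empty t h uniq))
              (trans (hole-turnChildren-actsAt h (attachLeft-actsAt x y) l r x∉ _)
                     (cong (K ∘ turnChildren l r) (attachLeft-here x y nil nil)))
    ; commutes = λ act → hole-turn-actsAt h act t
    }

  hole-empty : ∀ {rest us K} (t : BinTree (Fin n)) → Hole rest us K →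
               Unique (preorderOnto t us) →
               build (preorderOnto (withRightChild t) rest) ≡ K (turn t nil nil)
  hole-empty nil h _ = h .empty
  hole-empty (node l x nil) h (_ AllPairs.∷ uniq) = hole l h uniq .single x
  hole-empty {rest = rest} {K = K} (node l x r@(node l′ w r′)) h (_ AllPairs.∷ uniq) = begin
    build ((x , just w) ∷ preorderOnto (withRightChild l) vs)
      ≡⟨ build-just x w l _ _ ⟩
    attachRight w x (build (preorderOnto (withRightChild l) vs))
      -- In preorder `l` comes just before `r`, so `l` is built in the hole left by `r`, on the left
      -- of `w`.
      ≡⟨ cong (attachRight w x) (hole-empty l (hole r h uniq-r) uniq) ⟩
    attachRight w x (K (turnChildren l′ r′ (node (turn l nil nil) w nil)))
      -- `w` differs from the labels of `l′`, `r′` and `us`, so the insertion sinks to the subtree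
      -- topped by `w`.
      ≡⟨ hole-turnChildren-actsAt h (attachRight-actsAt w x) l′ r′ (AllPairs.head uniq-r) _ ⟩
    K (turnChildren l′ r′ (attachRight w x (node (turn l nil nil) w nil)))
      ≡⟨ cong (K ∘ turnChildren l′ r′) (attachRight-here w x (turn l nil nil) nil) ⟩
    K (turnChildren l′ r′ (node (turn l nil nil) w (node nil x nil)))
      ∎
    where
    open ≡-Reasoning
    vs = preorderOnto (withRightChild r) rest
    uniq-r = preorderOnto-suffix Unique AllPairs.tail l uniq

hole-[] : Hole {n} [] [] id
hole-[] = record { empty = refl ; single = λ _ → refl ; commutes = λ _ _ _ → refl }

build-turn : (T : BinTree (Fin n)) → Unique (preorder T) →
             build (preorder (withRightChild T)) ≡ turn T nil nil
build-turn T = hole-empty T hole-[]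

-- Preorder and labels of the turned tree.

++-assoc₃ : (xs ys : List A) (z : A) (zs : List A) →
            xs ++ ys ++ z ∷ zs ≡ (xs ++ ys ++ [ z ]) ++ zs
++-assoc₃ xs ys z zs =
  trans (cong (xs ++_) (sym (++-assoc ys [ z ] zs))) (sym (++-assoc xs (ys ++ [ z ]) zs))

-- The root of `t` comes last among the nodes of `t`, and its new children `L` and `R` follow it.
preorderOnto-turn : (t L R : BinTree A) → Fits t R → ∀ ys →
                    preorderOnto (turn t L R) ys
                    ≡ revPreorder t ++ preorderOnto L (preorderOnto R ys)
preorderOnto-turn nil            L nil _ ys = refl
preorderOnto-turn (node l x nil) L R   _ ys =
  trans (preorderOnto-turn l (node L x R) nil (fits-nil l) ys)
        (++-assoc₃ [] (revPreorder l) x _)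
preorderOnto-turn (node l x r@(node _ _ _)) L R _ ys = begin
  preorderOnto (turn r (turn l nil nil) (node L x R)) ys
    ≡⟨ preorderOnto-turn r (turn l nil nil) (node L x R) tt ys ⟩
  revPreorder r ++ preorderOnto (turn l nil nil) (x ∷ zs)
    ≡⟨ cong (revPreorder r ++_) (preorderOnto-turn l nil nil (fits-nil l) (x ∷ zs)) ⟩
  revPreorder r ++ revPreorder l ++ x ∷ zs
    ≡⟨ ++-assoc₃ (revPreorder r) (revPreorder l) x zs ⟩
  (revPreorder r ++ revPreorder l ++ [ x ]) ++ zs
    ∎
  where
  open ≡-Reasoning
  zs = preorderOnto L (preorderOnto R ys)

revPreorder-↭ : (t : BinTree A) → revPreorder t ↭ preorder t
revPreorder-↭ nil          = ↭-refl
revPreorder-↭ (node l x r) = begin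
  revPreorder r ++ revPreorder l ++ [ x ]
    ↭⟨ Perm.++⁺ (revPreorder-↭ r) (Perm.++⁺ʳ [ x ] (revPreorder-↭ l)) ⟩
  preorder r ++ preorder l ++ [ x ]    ↭⟨ Perm.shifts (preorder r) (preorder l) ⟩
  preorder l ++ preorder r ++ [ x ]    ≡⟨ ++-assoc (preorder l) _ _ ⟨
  (preorder l ++ preorder r) ++ [ x ]  ↭⟨ Perm.++-comm (preorder l ++ preorder r) [ x ] ⟩
  x ∷ preorder l ++ preorder r         ≡⟨ cong (x ∷_) (preorderOnto-++ l (preorder r)) ⟨
  preorder (node l x r)                ∎
  where open PermutationReasoning

-- Both lists are free of repetitions and contain all of `Fin n`, so they agree as bags.
map-opposite-allFin : (n : ℕ) → map opposite (allFin n) ↭ allFin n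
map-opposite-allFin n = ∼bag⇒↭ (unique∧set⇒bag
  (Unique.map⁺ opposite-injective (Unique.allFin⁺ n)) (Unique.allFin⁺ n)
  (λ {i} → mk⇔ (λ _ → ∈-allFin i)
               (λ _ → subst (_∈ map opposite (allFin n)) (opposite-involutive i)
                            (∈-map⁺ opposite (∈-allFin (opposite i))))))
  where
  opposite-injective : ∀ {i j} → opposite i ≡ opposite j → i ≡ j
  opposite-injective {i} {j} eq =
    trans (sym (opposite-involutive i)) (trans (cong opposite eq) (opposite-involutive j))

-- The right increasing condition.

opposite-anti-< : {i j : Fin n} → i < j → opposite j < opposite i
opposite-anti-< {n} {i} {j} i<j rewrite opposite-prop i | opposite-prop j =
  ℕ.∸-monoʳ-< (s≤s i<j) (toℕ<n j)

-- Turning reverses each right edge and `opposite` reverses the order, so the condition survives.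
-- The last hypothesis concerns the one right edge joining the pieces, from the root of `t` to the
-- root of `R`.
rightIncreasing-turn :
  (t : BinTree (Fin n)) (L R : BinTree (Fin n)) → Fits t R → RightIncreasing t →
  RightIncreasing (mapₙ opposite L) → RightIncreasing (mapₙ opposite R) →
  All (λ z → All (opposite z <_) (root (mapₙ opposite R))) (root t) →
  RightIncreasing (mapₙ opposite (turn t L R))
rightIncreasing-turn nil L nil _ _ incL _ _ = incL
rightIncreasing-turn (node l x nil) L R _ (_ , incl , _) incL incR (just x<) =
  rightIncreasing-turn l (node L x R) nil (fits-nil l) incl (x< , incL , incR) tt
    (MaybeAll.universal (λ _ → nothing) (root l))
rightIncreasing-turn (node l x r@(node _ _ _)) L R _ (just x<r , incl , incr) incL incR (just x<) =
  rightIncreasing-turn r (turn l nil nil) (node L x R) tt incr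
    (rightIncreasing-turn l nil nil (fits-nil l) incl tt tt
      (MaybeAll.universal (λ _ → nothing) (root l)))
    (x< , incL , incR) (just (just (opposite-anti-< x<r)))

-- Right chains.

rightEdges-mapₙ : (f : A → B) (t : BinTree A) → rightEdges (mapₙ f t) ≡ rightEdges t
rightEdges-mapₙ f nil          = refl
rightEdges-mapₙ f (node _ _ r) = cong suc (rightEdges-mapₙ f r)

rightChains-mapₙ : (f : A → B) (b : Bool) (t : BinTree A) →
                   rightChains b (mapₙ f t) ≡ rightChains b t
rightChains-mapₙ f b     nil          = refl
rightChains-mapₙ f false (node l _ r) =
  cong₂ _∷_ (rightEdges-mapₙ f r)
    (cong₂ _++_ (rightChains-mapₙ f false l) (rightChains-mapₙ f true r))
rightChains-mapₙ f true  (node l _ r) =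
  cong₂ _++_ (rightChains-mapₙ f false l) (rightChains-mapₙ f true r)

-- The chain through the root of t is extended by k edges.
extendedChains : BinTree A → ℕ → List ℕ
extendedChains nil            k = []
extendedChains t@(node _ _ r) k = rightEdges r + k ∷ rightChains true t

extendedChains-0 : (t : BinTree A) → extendedChains t 0 ≡ rightChainSequence t
extendedChains-0 nil          = refl
extendedChains-0 (node l x r) =
  cong (_∷ rightChains true (node l x r)) (ℕ.+-identityʳ (rightEdges r))

-- Each right chain is turned upside down, so the root of `t` ends at the bottom of its chain and
-- `R` lengthens that chain only. The top chain of `R` is absorbed, while `L`, hung on the left,
-- keeps all its chains.
rightChains-turn : (t L R : BinTree A) → Fits t R →
                   rightChains false (turn t L R)
                   ↭ extendedChains t (rightEdges R) ++ rightChains false L ++ rightChains true R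
rightChains-turn nil            L nil _ = ↭-reflexive (sym (++-identityʳ _))
rightChains-turn (node l x nil) L R   _ = begin
  rightChains false (turn l (node L x R) nil)
    ↭⟨ rightChains-turn l (node L x R) nil (fits-nil l) ⟩
  -- Here `x` is not a right child, so a chain starts at `x` and no chain of `l` is extended.
  extendedChains l 0 ++ (rightEdges R ∷ C) ++ []
    ≡⟨ cong₂ _++_ (extendedChains-0 l) (++-identityʳ _) ⟩
  rightChains false l ++ rightEdges R ∷ C
    ↭⟨ Perm.shift (rightEdges R) (rightChains false l) C ⟩
  rightEdges R ∷ rightChains false l ++ C
    ≡⟨ cong (λ cs → rightEdges R ∷ cs ++ C) (++-identityʳ (rightChains false l)) ⟨
  rightEdges R ∷ (rightChains false l ++ []) ++ C
    ∎
  where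
  open PermutationReasoning
  C = rightChains false L ++ rightChains true R
rightChains-turn (node l x r@(node _ _ r′)) L R _ = begin
  rightChains false (turn r (turn l nil nil) (node L x R))
    ↭⟨ rightChains-turn r (turn l nil nil) (node L x R) tt ⟩
  extendedChains r (suc (rightEdges R)) ++ rightChains false (turn l nil nil) ++ C
    ↭⟨ Perm.++⁺ˡ (extendedChains r _) (Perm.++⁺ʳ C (rightChains-turn l nil nil (fits-nil l))) ⟩
  extendedChains r (suc (rightEdges R)) ++ (extendedChains l 0 ++ []) ++ C
    ≡⟨ cong (λ cs → extendedChains r _ ++ cs ++ C)
            (trans (++-identityʳ _) (extendedChains-0 l)) ⟩
  extendedChains r (suc (rightEdges R)) ++ rightChains false l ++ C
    -- The edge between `x` and the root of `r` moves from the count below the root of `r` to the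
    -- count in `rightEdges r`.
    ≡⟨ cong (λ k → k ∷ rightChains true r ++ rightChains false l ++ C)
            (ℕ.+-suc (rightEdges r′) (rightEdges R)) ⟩
  k ∷ rightChains true r ++ rightChains false l ++ C
    ↭⟨ prep k (Perm.shifts (rightChains true r) (rightChains false l)) ⟩
  k ∷ rightChains false l ++ rightChains true r ++ C
    ≡⟨ cong (k ∷_) (++-assoc (rightChains false l) (rightChains true r) C) ⟨
  k ∷ (rightChains false l ++ rightChains true r) ++ C
    ∎
  where
  open PermutationReasoning
  k = rightEdges r + rightEdges R
  C = rightChains false L ++ rightChains true R

-- Right children after the turn.

isRightChild-mapₙ : (f : A → B) (b : Bool) (t : BinTree A) →
                    isRightChild b (mapₙ f t) ≡ isRightChild b t
isRightChild-mapₙ f b nil          = refl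
isRightChild-mapₙ f b (node l _ r) =
  cong₂ (λ l r → node l b r) (isRightChild-mapₙ f false l) (isRightChild-mapₙ f true r)

-- A node is hung on the right exactly when it has a right child in `t`. The last node in preorder
-- has none, which agrees with the mark `false` of the new root.
isRightChild-turn : (t L R : BinTree A) → Fits t R → ∀ ys →
                    preorderOnto (isRightChild false (turn t L R)) ys
                    ≡ revPreorder (hasRightChild t)
                      ++ preorderOnto (isRightChild false L) (preorderOnto (isRightChild true R) ys)
isRightChild-turn nil            L nil _ ys = refl
isRightChild-turn (node l x nil) L R   _ ys =
  trans (isRightChild-turn l (node L x R) nil (fits-nil l) ys)
        (++-assoc₃ [] (revPreorder (hasRightChild l)) false _)
isRightChild-turn (node l x r@(node _ _ _)) L R _ ys = begin
  preorderOnto (isRightChild false (turn r (turn l nil nil) (node L x R))) ys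
    ≡⟨ isRightChild-turn r (turn l nil nil) (node L x R) tt ys ⟩
  bs ++ preorderOnto (isRightChild false (turn l nil nil)) (true ∷ zs)
    ≡⟨ cong (bs ++_) (isRightChild-turn l nil nil (fits-nil l) (true ∷ zs)) ⟩
  bs ++ revPreorder (hasRightChild l) ++ true ∷ zs
    ≡⟨ ++-assoc₃ bs (revPreorder (hasRightChild l)) true zs ⟩
  (bs ++ revPreorder (hasRightChild l) ++ [ true ]) ++ zs
    ∎
  where
  open ≡-Reasoning
  bs = revPreorder (hasRightChild r)
  zs = preorderOnto (isRightChild false L) (preorderOnto (isRightChild true R) ys)

-- The properties of `ϑ`.

module _ {T : BinTree (Fin n)} (rb : RB n T) where

  open RB rb

  ϑ-turn : ϑ T ≡ mapₙ opposite (turn T nil nil)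
  ϑ-turn = cong (mapₙ opposite) (build-turn T
    (PermSetoid.Unique-resp-↭ (setoid (Fin n)) (↭⇒↭ₛ (↭-sym labels)) (Unique.allFin⁺ n)))

  ϑ-RB : RB n (ϑ T)
  ϑ-RB rewrite ϑ-turn = record
    { labels          = begin
        preorder (mapₙ opposite (turn T nil nil))
          ≡⟨ preorderOnto-mapₙ opposite (turn T nil nil) [] ⟩
        map opposite (preorder (turn T nil nil))
          ≡⟨ cong (map opposite) (preorderOnto-turn T nil nil (fits-nil T) []) ⟩
        map opposite (revPreorder T ++ [])
          ≡⟨ cong (map opposite) (++-identityʳ (revPreorder T)) ⟩
        map opposite (revPreorder T)  ↭⟨ Perm.map⁺ opposite (revPreorder-↭ T) ⟩
        map opposite (preorder T)     ↭⟨ Perm.map⁺ opposite labels ⟩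
        map opposite (allFin n)       ↭⟨ map-opposite-allFin n ⟩
        allFin n                      ∎
    ; rightIncreasing = rightIncreasing-turn T nil nil (fits-nil T) rightIncreasing tt tt
                          (MaybeAll.universal (λ _ → nothing) (root T))
    }
    where open PermutationReasoning

  rightChainSequence-ϑ : rightChainSequence (ϑ T) ↭ rightChainSequence T
  rightChainSequence-ϑ = begin
    rightChainSequence (ϑ T)
      ≡⟨ cong rightChainSequence ϑ-turn ⟩
    rightChainSequence (mapₙ opposite (turn T nil nil))
      ≡⟨ rightChains-mapₙ opposite false (turn T nil nil) ⟩
    rightChainSequence (turn T nil nil)
      ↭⟨ rightChains-turn T nil nil (fits-nil T) ⟩
    extendedChains T 0 ++ []
      ≡⟨ trans (++-identityʳ _) (extendedChains-0 T) ⟩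
    rightChainSequence T
      ∎
    where open PermutationReasoning

  spi-ϑ : spi (ϑ T) ≡ rspi T
  spi-ϑ = cong firstTrue (begin
    preorder (isRightChild false (ϑ T))
      ≡⟨ cong (preorder ∘ isRightChild false) ϑ-turn ⟩
    preorder (isRightChild false (mapₙ opposite (turn T nil nil)))
      ≡⟨ cong preorder (isRightChild-mapₙ opposite false (turn T nil nil)) ⟩
    preorder (isRightChild false (turn T nil nil))
      ≡⟨ isRightChild-turn T nil nil (fits-nil T) [] ⟩
    revPreorder (hasRightChild T) ++ []
      ≡⟨ ++-identityʳ _ ⟩
    revPreorder (hasRightChild T)
      ∎)
    where open ≡-Reasoning

-- Relabelling commutes with turning, so the two turns and the two uses of `opposite` cancel
-- separately. Reading the outer `ϑ` as a turn relies on `ϑ-RB`.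
ϑ-involutive : {T : BinTree (Fin n)} → RB n T → ϑ (ϑ T) ≡ T
ϑ-involutive {T = T} rb = begin
  ϑ (ϑ T)
    ≡⟨ ϑ-turn (ϑ-RB rb) ⟩
  mapₙ opposite (turn (ϑ T) nil nil)
    ≡⟨ cong (λ t → mapₙ opposite (turn t nil nil)) (ϑ-turn rb) ⟩
  mapₙ opposite (turn (mapₙ opposite (turn T nil nil)) nil nil)
    ≡⟨ cong (mapₙ opposite) (turn-mapₙ opposite (turn T nil nil) nil nil) ⟨
  mapₙ opposite (mapₙ opposite (turn (turn T nil nil) nil nil))
    ≡⟨ cong (mapₙ opposite ∘ mapₙ opposite) (turn-involutive T) ⟩
  mapₙ opposite (mapₙ opposite T)
    ≡⟨ map-compose T ⟨
  mapₙ (opposite ∘ opposite) T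
    ≡⟨ map-cong opposite-involutive (λ _ → refl) T ⟩
  mapₙ id T
    ≡⟨ map-id T ⟩
  T
    ∎
  where open ≡-Reasoning

theorem3p14 : (n : ℕ) → 1 ≤ n → (T : BinTree (Fin n)) → RB n T →
    RB n (ϑ T)
    × ϑ (ϑ T) ≡ T
    × rightChainSequence (ϑ T) ↭ rightChainSequence T
    × spi (ϑ T) ≡ rspi T
    × rspi (ϑ T) ≡ spi T
theorem3p14 n _ T rb =
  ϑ-RB rb , ϑ-involutive rb , rightChainSequence-ϑ rb , spi-ϑ rb ,
  trans (sym (spi-ϑ (ϑ-RB rb))) (cong spi (ϑ-involutive rb))
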